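{- Let $E$ be a homogeneous effect algebra having the maximality property. Then every block $B$ of $E$ is a lattice (with respect to the order of the effect algebra $B$), and therefore $B$ satisfies the difference-meet property.
   Context: An effect algebra is a partial algebra $(E;\oplus,0,1)$ with $0\neq 1$ and a partial binary operation $\oplus$ such that for all $x,y,z\in E$: (1) $x\oplus y=y\oplus x$ if $x\oplus y$ is defined; (2) $(x\oplus y)\oplus z=x\oplus(y\oplus z)$ if one side is defined; (3) for every $x$ there is a unique $y$ (denoted $x'$) with $x\oplus y=1$; (4) if $1\oplus x$ is defined then $x=0$. One writes $x\le y$ and $y\ominus x=z$ iff $x\oplus z$ is defined and equals $y$; $\le$ is a partial order. A sub-effect algebra of $E$ is a subset $Q\subseteq E$ with $1\in Q$ such that whenever $x\oplus y=z$ in $E$ and two of $x,y,z$ lie in $Q$, all three lie in $Q$; it is an effect algebra with the inherited operation. $E$ satisfies the Riesz decomposition property if $u\le v_1\oplus v_2$ implies $u=u_1\oplus u_2$ for some $u_1\le v_1$, $u_2\le v_2$. $E$ is homogeneous if $u\le v_1\oplus v_2\le u'$ implies $u=u_1\oplus u_2$ for some $u_1\le v_1$, $u_2\le v_2$. A block of a homogeneous effect algebra $E$ is a maximal sub-effect algebra of $E$ with the Riesz decomposition property. $E$ has the maximality property if for every $u,v\in E$ the set $\{u,v\}$ has a maximal lower bound (a maximal element of the set of its lower bounds). An effect algebra satisfies the difference-meet property if, for all $x,y,z$ with $x\le y$ such that the meets $x\wedge z$ and $y\wedge z$ exist, the meet $(y\ominus x)\wedge z$ exists. -}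

module Defs where

open import Level using (Level; _⊔_; suc)
open import Data.Product using (Σ; ∃; ∃₂; ∃!; _×_; _,_; proj₁; proj₂)
open import Relation.Binary.Core using (Rel)
open import Relation.Binary.Structures using (IsEquivalence)
open import Relation.Binary.Definitions using (_Respects_)
open import Relation.Binary.Lattice.Structures using (IsLattice)
open import Relation.Nullary using (¬_)
open import Relation.Unary using (Pred; _∈_; _⊆_)

private
  variable
    c ℓ p : Level

-- The partial operation is given by its graph: x ⊕ y ≐ z says that x ⊕ y is
-- defined and equal to z, so definedness of x ⊕ y is ∃ λ z → x ⊕ y ≐ z and is
-- not assumed decidable.  Equality is a setoid equality, so that a subset
-- Q carries an effect algebra on Σ Carrier Q whose equality ignores the
-- membership proofs.
record EffectAlgebra (c ℓ : Level) : Set (suc (c ⊔ ℓ)) where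
  infix 4 _≈_ _⊕_≐_ _⊖_≐_ _≤_
  field
    Carrier       : Set c
    _≈_           : Rel Carrier ℓ
    isEquivalence : IsEquivalence _≈_
    _⊕_≐_         : Carrier → Carrier → Carrier → Set ℓ
    0# 1#         : Carrier

    ⊕-resp        : ∀ {x x₁ y y₁ z z₁} → x ≈ x₁ → y ≈ y₁ → z ≈ z₁ →
                    x ⊕ y ≐ z → x₁ ⊕ y₁ ≐ z₁
    ⊕-functional  : ∀ {x y z z₁} → x ⊕ y ≐ z → x ⊕ y ≐ z₁ → z ≈ z₁

    0≉1           : ¬ (0# ≈ 1#)
    ⊕-comm        : ∀ {x y z} → x ⊕ y ≐ z → y ⊕ x ≐ z
    ⊕-assocʳ      : ∀ {x y z xy s} → x ⊕ y ≐ xy → xy ⊕ z ≐ s →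
                    ∃ λ yz → y ⊕ z ≐ yz × x ⊕ yz ≐ s
    ⊕-assocˡ      : ∀ {x y z yz s} → y ⊕ z ≐ yz → x ⊕ yz ≐ s →
                    ∃ λ xy → x ⊕ y ≐ xy × xy ⊕ z ≐ s
    complement    : ∀ x → ∃! _≈_ (λ y → x ⊕ y ≐ 1#)
    1⊕-defined    : ∀ {x z} → 1# ⊕ x ≐ z → x ≈ 0#

  _′ : Carrier → Carrier
  x ′ = proj₁ (complement x)

  _≤_ : Rel Carrier (c ⊔ ℓ)
  x ≤ y = ∃ λ z → x ⊕ z ≐ y

  _⊖_≐_ : Carrier → Carrier → Carrier → Set ℓ
  y ⊖ x ≐ z = x ⊕ z ≐ y

  LowerBound : Carrier → Carrier → Pred Carrier (c ⊔ ℓ)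
  LowerBound u v w = w ≤ u × w ≤ v

  IsMaximalLowerBound : Carrier → Carrier → Pred Carrier (c ⊔ ℓ)
  IsMaximalLowerBound u v w =
    LowerBound u v w × (∀ t → LowerBound u v t → w ≤ t → t ≈ w)

  IsMeet : Carrier → Carrier → Pred Carrier (c ⊔ ℓ)
  IsMeet u v w = LowerBound u v w × (∀ t → LowerBound u v t → t ≤ w)

  HasMeet : Rel Carrier (c ⊔ ℓ)
  HasMeet u v = ∃ (IsMeet u v)

module _ (E : EffectAlgebra c ℓ) where
  open EffectAlgebra E

  RieszDecomposition : Set (c ⊔ ℓ)
  RieszDecomposition = ∀ u v₁ v₂ v → v₁ ⊕ v₂ ≐ v → u ≤ v →
    ∃₂ λ u₁ u₂ → u₁ ≤ v₁ × u₂ ≤ v₂ × u₁ ⊕ u₂ ≐ u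

  Homogeneous : Set (c ⊔ ℓ)
  Homogeneous = ∀ u v₁ v₂ v → v₁ ⊕ v₂ ≐ v → u ≤ v → v ≤ u ′ →
    ∃₂ λ u₁ u₂ → u₁ ≤ v₁ × u₂ ≤ v₂ × u₁ ⊕ u₂ ≐ u

  MaximalityProperty : Set (c ⊔ ℓ)
  MaximalityProperty = ∀ u v → ∃ (IsMaximalLowerBound u v)

  DifferenceMeet : Set (c ⊔ ℓ)
  DifferenceMeet = ∀ x y z d → x ≤ y → HasMeet x z → HasMeet y z →
    y ⊖ x ≐ d → HasMeet d z

  LatticeOrdered : Set (c ⊔ ℓ)
  LatticeOrdered = ∃₂ λ _∨_ _∧_ → IsLattice _≈_ _≤_ _∨_ _∧_

  record IsSubEffectAlgebra (Q : Pred Carrier p) : Set (c ⊔ ℓ ⊔ p) where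
    field
      resp     : Q Respects _≈_
      1∈       : 1# ∈ Q
      sum∈     : ∀ {x y z} → x ⊕ y ≐ z → x ∈ Q → y ∈ Q → z ∈ Q
      summandʳ : ∀ {x y z} → x ⊕ y ≐ z → x ∈ Q → z ∈ Q → y ∈ Q
      summandˡ : ∀ {x y z} → x ⊕ y ≐ z → y ∈ Q → z ∈ Q → x ∈ Q

    -- Since 1 ⊕ 1′ = 1, axiom 1⊕-defined gives 1′ = 0.
    0∈ : 0# ∈ Q
    0∈ = resp (1⊕-defined 1⊕1′) (summandʳ 1⊕1′ 1∈ 1∈)
      where
      1⊕1′ : 1# ⊕ 1# ′ ≐ 1#
      1⊕1′ = proj₁ (proj₂ (complement 1#))

  subEffectAlgebra : {Q : Pred Carrier p} → IsSubEffectAlgebra Q →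
                     EffectAlgebra (c ⊔ p) ℓ
  subEffectAlgebra {Q = Q} sub = record
    { Carrier       = Σ Carrier Q
    ; _≈_           = λ x y → proj₁ x ≈ proj₁ y
    ; isEquivalence = record { refl = refl ; sym = sym ; trans = trans }
    ; _⊕_≐_         = λ x y z → proj₁ x ⊕ proj₁ y ≐ proj₁ z
    ; 0#            = 0# , 0∈
    ; 1#            = 1# , 1∈
    ; ⊕-resp        = ⊕-resp
    ; ⊕-functional  = ⊕-functional
    ; 0≉1           = 0≉1
    ; ⊕-comm        = ⊕-comm
    ; ⊕-assocʳ      = λ { {_} {_ , y∈} {_ , z∈} x⊕y xy⊕z →
        let yz , y⊕z , x⊕yz = ⊕-assocʳ x⊕y xy⊕z
        in (yz , sum∈ y⊕z y∈ z∈) , y⊕z , x⊕yz }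
    ; ⊕-assocˡ      = λ { {_ , x∈} {_ , y∈} y⊕z x⊕yz →
        let xy , x⊕y , xy⊕z = ⊕-assocˡ y⊕z x⊕yz
        in (xy , sum∈ x⊕y x∈ y∈) , x⊕y , xy⊕z }
    ; complement    = λ { (x , x∈) →
        let x⊕x′ , unique = proj₂ (complement x)
        in (x ′ , summandʳ x⊕x′ x∈ 1∈) , x⊕x′ , unique }
    ; 1⊕-defined    = 1⊕-defined
    }
    where
    open IsEquivalence isEquivalence
    open IsSubEffectAlgebra sub

module _ (E : EffectAlgebra c ℓ) where
  open EffectAlgebra E using (Carrier)

  -- Maximality ranges over subsets in the same universe level as B.
  record IsBlock (B : Pred Carrier p) : Set (c ⊔ ℓ ⊔ suc p) where
    field
      isSubEffectAlgebra : IsSubEffectAlgebra E B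

    algebra : EffectAlgebra (c ⊔ p) ℓ
    algebra = subEffectAlgebra E isSubEffectAlgebra

    field
      riesz   : RieszDecomposition algebra
      maximal : ∀ (Q : Pred Carrier p) (sub : IsSubEffectAlgebra E Q) →
                RieszDecomposition (subEffectAlgebra E sub) →
                B ⊆ Q → Q ⊆ B

{-# OPTIONS --safe #-}
module Submission where

-- The crux is that a block B contains every u with u ≤ x and u ≤ x ′ for some
-- x ∈ B.  Decompose 1 first inside B, and then repeatedly replace a summand e by
-- u ⊕ r where u ≤ e ≤ u ′.  By homogeneity any two such decompositions have a
-- common refinement of the same kind, so the subsums of all of them form a
-- sub-effect algebra with the Riesz decomposition property; it contains B and
-- every such u, hence equals B by maximality.
--
-- For y , z ∈ B, Riesz decomposition of y ≤ z ⊕ z ′ gives y = v ⊕ y₁ and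
-- z = v ⊕ z₁ with y₁ ⊥ z₁.  A maximal lower bound u of y₁ and z₁ satisfies
-- u ≤ z and u ≤ z ′, so u ∈ B; the remainders y₁ ⊖ u and z₁ ⊖ u have only 0
-- as common lower bound, and Riesz decomposition makes v ⊕ u the meet of y and z.

open import Defs
open import Level using (Level; _⊔_)
open import Data.Bool using (Bool; true; false; not; _∧_; _∨_)
open import Data.Product using (Σ; ∃; ∃₂; _×_; _,_; proj₁; proj₂)
open import Function using (_∘_; id; const)
open import Relation.Binary.Core using (Rel)
open import Relation.Binary.Structures using (IsEquivalence)
open import Relation.Binary.PropositionalEquality as ≡ using (_≡_)
open import Relation.Unary using (Pred; _∈_; _⊆_)

private
  variable
    c ℓ : Level

-- Arithmetic and order in effect algebras.

module EffectAlgebraProperties (E : EffectAlgebra c ℓ) where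
  open EffectAlgebra E
  open IsEquivalence isEquivalence public

  private
    variable
      a b d e g h r s t u v w x y z x₁ y₁ z₁ xy yz : Carrier

  infix 4 _⊥_

  _⊥_ : Rel Carrier (c ⊔ ℓ)
  x ⊥ y = ∃ λ z → x ⊕ y ≐ z

  ⊕-respˡ : x ≈ x₁ → x ⊕ y ≐ z → x₁ ⊕ y ≐ z
  ⊕-respˡ p = ⊕-resp p refl refl

  ⊕-respʳ : y ≈ y₁ → x ⊕ y ≐ z → x ⊕ y₁ ≐ z
  ⊕-respʳ p = ⊕-resp refl p refl

  ⊕-resp-sum : z ≈ z₁ → x ⊕ y ≐ z → x ⊕ y ≐ z₁
  ⊕-resp-sum p = ⊕-resp refl refl p

  ⊕-assocʳ-≐ : x ⊕ y ≐ xy → xy ⊕ z ≐ s → y ⊕ z ≐ yz → x ⊕ yz ≐ s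
  ⊕-assocʳ-≐ p q r with ⊕-assocʳ p q
  ... | _ , r₁ , k = ⊕-respʳ (⊕-functional r₁ r) k

  ⊕-assocˡ-≐ : y ⊕ z ≐ yz → x ⊕ yz ≐ s → x ⊕ y ≐ xy → xy ⊕ z ≐ s
  ⊕-assocˡ-≐ p q r with ⊕-assocˡ p q
  ... | _ , r₁ , k = ⊕-respˡ (⊕-functional r₁ r) k

  ⊕-complement : ∀ x → x ⊕ x ′ ≐ 1#
  ⊕-complement x = proj₁ (proj₂ (complement x))

  complement-unique : x ⊕ y ≐ 1# → x ⊕ z ≐ 1# → y ≈ z
  complement-unique {x = x} p q =
    trans (sym (proj₂ (proj₂ (complement x)) p)) (proj₂ (proj₂ (complement x)) q)

  -- Since `1# ′` is zero, `x ⊕ 0#` is a complement of `x ′`, and so is `x`.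
  ⊕-identityʳ : ∀ x → x ⊕ 0# ≐ x
  ⊕-identityʳ x with ⊕-assocʳ (⊕-comm (⊕-complement x))
                       (⊕-respʳ (1⊕-defined (⊕-complement 1#)) (⊕-complement 1#))
  ... | _ , p , q =
    ⊕-resp-sum (complement-unique q (⊕-comm (⊕-complement x))) p

  ⊕-identityˡ : ∀ x → 0# ⊕ x ≐ x
  ⊕-identityˡ x = ⊕-comm (⊕-identityʳ x)

  -- Both `y` and `y₁` are complements of `x ⊕ z ′`.
  ⊕-cancelˡ : x ⊕ y ≐ z → x ⊕ y₁ ≐ z → y ≈ y₁
  ⊕-cancelˡ {z = z} p q with ⊕-assocʳ (⊕-comm p) (⊕-complement z)
  ... | _ , k , m = complement-unique (⊕-comm m)
        (⊕-comm (⊕-assocʳ-≐ (⊕-comm q) (⊕-complement z) k))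

  x⊕y≐x⇒y≈0 : x ⊕ y ≐ x → y ≈ 0#
  x⊕y≐x⇒y≈0 {x = x} p = ⊕-cancelˡ p (⊕-identityʳ x)

  -- As `0# ⊕ 1#` is defined, reassociation makes `y ⊕ 1#` defined.
  x⊕y≐0⇒y≈0 : x ⊕ y ≐ 0# → y ≈ 0#
  x⊕y≐0⇒y≈0 p with ⊕-assocʳ p (⊕-identityˡ 1#)
  ... | _ , q , _ = 1⊕-defined (⊕-comm q)

  x⊕y≐0⇒x≈0 : x ⊕ y ≐ 0# → x ≈ 0#
  x⊕y≐0⇒x≈0 p = x⊕y≐0⇒y≈0 (⊕-comm p)

  ⊕-medial : a ⊕ b ≐ g → d ⊕ e ≐ h → g ⊕ h ≐ s →
             ∃₂ λ v w → a ⊕ d ≐ v × b ⊕ e ≐ w × v ⊕ w ≐ s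
  ⊕-medial p q r =
    let _ , b⊕h , a⊕bh = ⊕-assocʳ p r
        _ , b⊕d , bd⊕e = ⊕-assocˡ q b⊕h
        _ , b⊕e , d⊕be = ⊕-assocʳ (⊕-comm b⊕d) bd⊕e
        _ , a⊕d , ad⊕be = ⊕-assocˡ d⊕be a⊕bh
    in _ , _ , a⊕d , b⊕e , ad⊕be

  ⊕-medial-≐ : a ⊕ b ≐ g → d ⊕ e ≐ h → g ⊕ h ≐ s →
               a ⊕ d ≐ v → b ⊕ e ≐ w → v ⊕ w ≐ s
  ⊕-medial-≐ p q r k m with ⊕-medial p q r
  ... | _ , _ , k₁ , m₁ , n =
    ⊕-resp (⊕-functional k₁ k) (⊕-functional m₁ m) refl n

  ⊕-remainder : a ⊕ b ≐ g → d ⊕ e ≐ h → g ⊕ h ≐ s →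
                a ⊕ d ≐ v → v ⊕ w ≐ s → b ⊕ e ≐ w
  ⊕-remainder p q r k m with ⊕-medial p q r
  ... | _ , _ , k₁ , m₁ , n =
    ⊕-resp-sum (⊕-cancelˡ (⊕-respˡ (⊕-functional k₁ k) n) m) m₁

  ≤-refl : x ≤ x
  ≤-refl {x = x} = 0# , ⊕-identityʳ x

  ≤-reflexive : x ≈ y → x ≤ y
  ≤-reflexive {x = x} p = 0# , ⊕-resp-sum p (⊕-identityʳ x)

  ≤-trans : x ≤ y → y ≤ z → x ≤ z
  ≤-trans (_ , p) (_ , q) with ⊕-assocʳ p q
  ... | _ , _ , k = _ , k

  ≤-antisym : x ≤ y → y ≤ x → x ≈ y
  ≤-antisym {x = x} (_ , p) (_ , q) with ⊕-assocʳ p q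
  ... | _ , k , m =
    ⊕-functional (⊕-identityʳ x)
      (⊕-respʳ (x⊕y≐0⇒x≈0 (⊕-resp-sum (x⊕y≐x⇒y≈0 m) k)) p)

  ⊥-comm : x ⊥ y → y ⊥ x
  ⊥-comm (_ , p) = _ , ⊕-comm p

  ⊥-mono : x ≤ x₁ → y ≤ y₁ → x₁ ⊥ y₁ → x ⊥ y
  ⊥-mono (_ , p) (_ , q) (_ , r) with ⊕-medial p q r
  ... | _ , _ , k , _ = _ , k

  ⊥⇒≤′ : x ⊥ y → y ≤ x ′
  ⊥⇒≤′ {x = x} (z , p) with ⊕-assocʳ p (⊕-complement z)
  ... | _ , k , m = _ , ⊕-resp-sum (complement-unique m (⊕-complement x)) k

  ≤′⇒⊥ : y ≤ x ′ → x ⊥ y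
  ≤′⇒⊥ {x = x} (_ , p) with ⊕-assocˡ p (⊕-complement x)
  ... | _ , k , _ = _ , k

  ′-antitone : x ≤ y → y ′ ≤ x ′
  ′-antitone {y = y} x≤y = ⊥⇒≤′ (⊥-mono x≤y ≤-refl (1# , ⊕-complement y))

  ≤′-swap : x ≤ y ′ → y ≤ x ′
  ≤′-swap x≤y′ = ⊥⇒≤′ (⊥-comm (≤′⇒⊥ x≤y′))

  -- Lattice order and existence of meets.

  module _ (_⊓_ : Carrier → Carrier → Carrier)
           (meet : ∀ x y → IsMeet x y (x ⊓ y)) where

    lattice : LatticeOrdered E
    lattice = (λ x y → ((x ′) ⊓ (y ′)) ′) , _⊓_ , record
      { isPartialOrder = record
        { isPreorder = record
          { isEquivalence = isEquivalence
          ; reflexive     = ≤-reflexive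
          ; trans         = ≤-trans
          }
        ; antisym = ≤-antisym
        }
      ; supremum = λ x y →
          let (≤x′ , ≤y′) , greatest = meet (x ′) (y ′)
          in ≤′-swap ≤x′ , ≤′-swap ≤y′ , λ z x≤z y≤z →
               let z′≤ = greatest (z ′) (′-antitone x≤z , ′-antitone y≤z)
               in ≤-trans (′-antitone z′≤) (≤-reflexive (complement-unique
                    (⊕-complement (z ′)) (⊕-comm (⊕-complement z))))
      ; infimum = λ x y →
          let (≤x , ≤y) , greatest = meet x y
          in ≤x , ≤y , λ z z≤x z≤y → greatest z (z≤x , z≤y)
      }

  module _ (riesz : RieszDecomposition E) where

    -- Split `t ≤ w ⊕ a` as `t₁ ⊕ t₂` and write `w` as `t₁ ⊕ r`. Cancelling `t₁` from `t ≤ w ⊕ b`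
    -- gives `t₂ ≤ r ⊕ b`. In a second decomposition the part below `b` is also below `a`, so it
    -- vanishes; thus `t₂ ≤ r` and `t ≤ w`.
    isMeet : w ⊕ a ≐ y → w ⊕ b ≐ z →
             (∀ t → t ≤ a → t ≤ b → t ≈ 0#) → IsMeet y z w
    isMeet {w} {a} {y} {b} {z} w⊕a w⊕b disjoint = ((a , w⊕a) , (b , w⊕b)) , below
      where
      below : ∀ t → LowerBound y z t → t ≤ w
      below t (t≤y , (k , t⊕k)) with riesz t w a y w⊕a t≤y
      ... | t₁ , t₂ , (r , t₁⊕r) , t₂≤a , t₁⊕t₂ with ⊕-assocʳ t₁⊕r w⊕b | ⊕-assocʳ t₁⊕t₂ t⊕k
      ... | rb , r⊕b , t₁⊕rb | m , t₂⊕k , t₁⊕m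
        with riesz t₂ r b rb r⊕b (k , ⊕-resp-sum (⊕-cancelˡ t₁⊕m t₁⊕rb) t₂⊕k)
      ... | s₁ , s₂ , (q , s₁⊕q) , s₂≤b , s₁⊕s₂ =
        q , ⊕-assocˡ-≐ t₂⊕q t₁⊕r t₁⊕t₂
        where
        s₂≈0 : s₂ ≈ 0#
        s₂≈0 = disjoint s₂ (≤-trans (s₁ , ⊕-comm s₁⊕s₂) t₂≤a) s₂≤b
        t₂⊕q : t₂ ⊕ q ≐ r
        t₂⊕q = ⊕-respˡ (⊕-functional (⊕-identityʳ s₁) (⊕-respʳ s₂≈0 s₁⊕s₂)) s₁⊕q

    -- Riesz decomposition along `z ⊕ z ′` reduces to orthogonal pairs; in a block, this
    -- orthogonality is what brings `u` into the block.
    hasMeet : (∀ x y → x ⊥ y → ∃ λ u → ∃₂ λ a b → u ⊕ a ≐ x × u ⊕ b ≐ y ×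
                 (∀ t → t ≤ a → t ≤ b → t ≈ 0#)) →
              ∀ y z → HasMeet y z
    hasMeet disjointify y z
      with riesz y z (z ′) 1# (⊕-complement z) (y ′ , ⊕-complement y)
    ... | v , y₁ , (z₁ , v⊕z₁) , y₁≤z′ , v⊕y₁
      with disjointify y₁ z₁
             (⊥-mono y₁≤z′ (v , ⊕-comm v⊕z₁) (_ , ⊕-comm (⊕-complement z)))
    ... | u , a , b , u⊕a , u⊕b , disjoint with ⊕-assocˡ u⊕a v⊕y₁
    ... | w , v⊕u , w⊕a = w , isMeet w⊕a (⊕-assocˡ-≐ u⊕b v⊕z₁ v⊕u) disjoint

-- Decomposition trees and their measures.

module Trees (E : EffectAlgebra c ℓ) (homogeneous : Homogeneous E)
  (B : Pred (EffectAlgebra.Carrier E) (c ⊔ ℓ)) (sub : IsSubEffectAlgebra E B)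
  (riesz : RieszDecomposition (subEffectAlgebra E sub)) where

  open EffectAlgebra E
  open EffectAlgebraProperties E
  private
    module B = IsSubEffectAlgebra sub
    variable
      a b d e g h r s t u v w x y z : Carrier
      K K₁ K₂ : Set

  data Layer : Set where
    fine coarse : Layer

  private
    variable
      l : Layer

  -- A fine split z = x ⊕ y has x ≤ z ≤ x ′, so homogeneity refines it against
  -- any other decomposition of z; coarse splits are refined by the Riesz
  -- property of B.  Hence coarse splits come above fine ones in a tree.
  data Cut : Layer → Carrier → Carrier → Carrier → Set (c ⊔ ℓ) where
    fine   : x ⊕ y ≐ z → Cut fine x y z
    coarse : x ∈ B → y ∈ B → x ⊕ y ≐ z → Cut coarse x y z

  -- Splits are the nodes of trees, cuts divide trees. A cut carries no orthogonality, so a coarse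
  -- one can be weakened to a fine one and applied to a fine tree.
  data Split : Layer → Carrier → Carrier → Carrier → Set (c ⊔ ℓ) where
    fine   : x ⊥ z → x ⊕ y ≐ z → Split fine x y z
    coarse : x ∈ B → y ∈ B → x ⊕ y ≐ z → Split coarse x y z

  cut-≐ : Cut l x y z → x ⊕ y ≐ z
  cut-≐ (fine p)       = p
  cut-≐ (coarse _ _ p) = p

  split⇒cut : Split l x y z → Cut l x y z
  split⇒cut (fine _ p)     = fine p
  split⇒cut (coarse p q r) = coarse p q r

  split-≐ : Split l x y z → x ⊕ y ≐ z
  split-≐ = cut-≐ ∘ split⇒cut

  cut⇒fine : Cut l x y z → Cut fine x y z
  cut⇒fine = fine ∘ cut-≐

  -- Decomposing `v` along `g ⊕ h` gives a two-by-two array with row sums `g`, `h` and column sums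
  -- `v`, `s`, the last by cancellation. The rows stay splits: in the fine case `a` and `d` lie
  -- below `v`, and `g` and `h` below `e`.
  diamond : Cut l g h e → Split l v s e →
            ∃₂ λ a b → ∃₂ λ d r →
            Split l a b g × Split l d r h × Cut l a d v × Cut l b r s
  diamond {g = g} {h} {e} {v} (fine g⊕h) (fine v⊥e v⊕s)
    with homogeneous v g h e g⊕h (_ , v⊕s) (⊥⇒≤′ v⊥e)
  ... | a , d , (b , a⊕b) , (r , d⊕r) , a⊕d =
    a , b , d , r
    , fine (⊥-mono (_ , a⊕d) (_ , g⊕h) v⊥e) a⊕b
    , fine (⊥-mono (_ , ⊕-comm a⊕d) (_ , ⊕-comm g⊕h) v⊥e) d⊕r
    , fine a⊕d
    , fine (⊕-remainder a⊕b d⊕r g⊕h a⊕d v⊕s)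
  diamond {g = g} {h} {e} {v} {s} (coarse g∈ h∈ g⊕h) (coarse v∈ s∈ v⊕s)
    with riesz (v , v∈) (g , g∈) (h , h∈) (e , B.sum∈ g⊕h g∈ h∈) g⊕h ((s , s∈) , v⊕s)
  ... | (a , a∈) , (d , d∈) , ((b , b∈) , a⊕b) , ((r , r∈) , d⊕r) , a⊕d =
    a , b , d , r
    , coarse a∈ b∈ a⊕b
    , coarse d∈ r∈ d⊕r
    , coarse a∈ d∈ a⊕d
    , coarse b∈ r∈ (⊕-remainder a⊕b d⊕r g⊕h a⊕d v⊕s)

  -- The colors in K mark which leaves to add up.  Working with the measure μ
  -- below, instead of with the leaves themselves, makes it irrelevant that
  -- refining two trees reorders and regroups their leaves.
  data Tree (K : Set) : Layer → Carrier → Set (c ⊔ ℓ) where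
    leaf : K → Tree K fine e
    node : Split l u r e → Tree K l u → Tree K l r → Tree K l e
    base : Tree K fine e → Tree K coarse e

  map : (K₁ → K₂) → Tree K₁ l e → Tree K₂ l e
  map f (leaf k)     = leaf (f k)
  map f (node p T U) = node p (map f T) (map f U)
  map f (base T)     = base (map f T)

  share : Bool → ∀ e → ∃₂ λ x y → x ⊕ y ≐ e
  share true  e = e , 0# , ⊕-identityʳ e
  share false e = 0# , e , ⊕-identityˡ e

  share-⊕ : g ⊕ h ≐ e → ∀ b → proj₁ (share b g) ⊕ proj₁ (share b h) ≐ proj₁ (share b e)
  share-⊕ p true  = p
  share-⊕ p false = ⊕-identityʳ 0#

  -- Carrying the sum of the unselected leaves along makes the sum of the
  -- selected ones defined at every node.
  select : Tree K l e → (K → Bool) → ∃₂ λ x y → x ⊕ y ≐ e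
  select {e = e} (leaf k) S = share (S k) e
  select (node p T U) S =
    let _ , _ , q = select T S
        _ , _ , r = select U S
        x , y , _ , _ , k = ⊕-medial q r (split-≐ p)
    in x , y , k
  select (base T) S = select T S

  μ : Tree K l e → (K → Bool) → Carrier
  μ T S = proj₁ (select T S)

  μ-node : (p : Split l u r e) (T : Tree K l u) (U : Tree K l r) (S : K → Bool) →
           μ T S ⊕ μ U S ≐ μ (node p T U) S
  μ-node p T U S =
    let _ , _ , k , _ = ⊕-medial (proj₂ (proj₂ (select T S)))
                                 (proj₂ (proj₂ (select U S))) (split-≐ p)
    in k

  ≐-cong : x ≈ a → y ≈ b → x ⊕ y ≐ z → a ⊕ b ≐ w → z ≈ w
  ≐-cong p q r k = ⊕-functional (⊕-resp p q refl r) k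

  μ-map : (f : K₁ → K₂) (T : Tree K₁ l e) (S : K₂ → Bool) → μ (map f T) S ≈ μ T (S ∘ f)
  μ-map f (leaf k)     S = refl
  μ-map f (node p T U) S =
    ≐-cong (μ-map f T S) (μ-map f U S)
      (μ-node p (map f T) (map f U) S) (μ-node p T U (S ∘ f))
  μ-map f (base T)     S = μ-map f T S

  μ-const : (T : Tree K l e) (b : Bool) → μ T (const b) ≈ proj₁ (share b e)
  μ-const (leaf k)     b     = refl
  μ-const (node p T U) true  =
    ≐-cong (μ-const T true) (μ-const U true) (μ-node p T U (const true)) (split-≐ p)
  μ-const (node p T U) false =
    ≐-cong (μ-const T false) (μ-const U false) (μ-node p T U (const false)) (⊕-identityʳ 0#)
  μ-const (base T)     b     = μ-const T b

  -- The partial sum of the two-element effect algebra; pointwise it is disjoint union of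
  -- selections.
  data _⊎_≐_ : Bool → Bool → Bool → Set where
    left    : true  ⊎ false ≐ true
    right   : false ⊎ true  ≐ true
    neither : false ⊎ false ≐ false

  μ-additive : (T : Tree K l e) {S₁ S₂ S : K → Bool} →
               (∀ k → S₁ k ⊎ S₂ k ≐ S k) → μ T S₁ ⊕ μ T S₂ ≐ μ T S
  μ-additive {e = e} (leaf k) {S₁} {S₂} {S} p = lemma (p k)
    where
    lemma : ∀ {b₁ b₂ b} → b₁ ⊎ b₂ ≐ b →
            proj₁ (share b₁ e) ⊕ proj₁ (share b₂ e) ≐ proj₁ (share b e)
    lemma left    = ⊕-identityʳ e
    lemma right   = ⊕-identityˡ e
    lemma neither = ⊕-identityʳ 0#
  μ-additive (node q T U) {S₁} {S₂} {S} p =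
    ⊕-medial-≐ (μ-additive T p) (μ-additive U p) (μ-node q T U S)
      (μ-node q T U S₁) (μ-node q T U S₂)
  μ-additive (base T) p = μ-additive T p

  -- Division and common refinement of trees.

  divide : Cut l g h e → (T : Tree K l e) →
           Σ (Tree K l g) λ U → Σ (Tree K l h) λ V → ∀ S → μ U S ⊕ μ V S ≐ μ T S
  divide (fine p) (leaf k) = leaf k , leaf k , λ S → share-⊕ p (S k)
  -- The cut is pushed below the split, and each half of a leaf eventually inherits its color.
  divide c (node p T U) with diamond c p
  ... | _ , _ , _ , _ , pg , ph , cT , cU with divide cT T | divide cU U
  ... | T₁ , T₂ , T≐ | U₁ , U₂ , U≐ =
    node pg T₁ U₁ , node ph T₂ U₂ , λ S →
      ⊕-medial-≐ (T≐ S) (U≐ S) (μ-node p T U S)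
        (μ-node pg T₁ U₁ S) (μ-node ph T₂ U₂ S)
  divide c (base T) with divide (cut⇒fine c) T
  ... | U , V , T≐ = base U , base V , T≐

  -- A leaf keeps its color from both trees, so selections of either pull back along a projection
  -- without changing their measure.
  record Refinement (T : Tree K₁ l e) {l′} (U : Tree K₂ l′ e) l″ : Set (c ⊔ ℓ) where
    field
      tree : Tree (K₁ × K₂) l″ e
      μ-fst : ∀ S → μ tree (S ∘ proj₁) ≈ μ T S
      μ-snd : ∀ S → μ tree (S ∘ proj₂) ≈ μ U S

  open Refinement

  refine-node : {l′ l″ : Layer} (p : Split l u r e) (q : Split l″ u r e)
    {T : Tree K₁ l u} {U : Tree K₁ l r} (W : Tree K₂ l′ e)
    {W₁ : Tree K₂ l′ u} {W₂ : Tree K₂ l′ r} → (∀ S → μ W₁ S ⊕ μ W₂ S ≐ μ W S) →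
    Refinement T W₁ l″ → Refinement U W₂ l″ → Refinement (node p T U) W l″
  refine-node p q {T} {U} W W≐ R₁ R₂ = record
    { tree  = node q (tree R₁) (tree R₂)
    ; μ-fst = λ S → ≐-cong (μ-fst R₁ S) (μ-fst R₂ S)
        (μ-node q (tree R₁) (tree R₂) (S ∘ proj₁)) (μ-node p T U S)
    ; μ-snd = λ S → ≐-cong (μ-snd R₁ S) (μ-snd R₂ S)
        (μ-node q (tree R₁) (tree R₂) (S ∘ proj₂)) (W≐ S)
    }

  refine-swap : {l′ l″ : Layer} {T : Tree K₁ l e} {U : Tree K₂ l′ e} →
    Refinement T U l″ → Refinement U T l″
  refine-swap R = record
    { tree  = map (λ (i , j) → j , i) (tree R)
    ; μ-fst = λ S → trans (μ-map _ (tree R) (S ∘ proj₁)) (μ-snd R S)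
    ; μ-snd = λ S → trans (μ-map _ (tree R) (S ∘ proj₂)) (μ-fst R S)
    }

  refine-fine : (T : Tree K₁ fine e) (U : Tree K₂ fine e) → Refinement T U fine
  refine-fine (leaf k) U = record
    { tree  = map (k ,_) U
    ; μ-fst = λ S → trans (μ-map (k ,_) U (S ∘ proj₁)) (μ-const U (S k))
    ; μ-snd = λ S → μ-map (k ,_) U (S ∘ proj₂)
    }
  refine-fine (node p T₁ T₂) U with divide (split⇒cut p) U
  ... | U₁ , U₂ , U≐ = refine-node p p U U≐ (refine-fine T₁ U₁) (refine-fine T₂ U₂)

  refine-mixed : (T : Tree K₁ coarse e) (U : Tree K₂ fine e) → Refinement T U coarse
  refine-mixed (base T) U = record
    { tree = base (tree R) ; μ-fst = μ-fst R ; μ-snd = μ-snd R }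
    where R = refine-fine T U
  refine-mixed (node p T₁ T₂) U with divide (cut⇒fine (split⇒cut p)) U
  ... | U₁ , U₂ , U≐ = refine-node p p U U≐ (refine-mixed T₁ U₁) (refine-mixed T₂ U₂)

  -- The coarse nodes of `U` are peeled off first, then those of `T` in `refine-mixed`, until two
  -- fine trees remain. The swaps are there because `refine-node` follows the nodes of its first
  -- tree.
  refine : (T : Tree K₁ coarse e) (U : Tree K₂ coarse e) → Refinement T U coarse
  refine T (base U) = record { tree = tree R ; μ-fst = μ-fst R ; μ-snd = μ-snd R }
    where R = refine-mixed T U
  refine T (node p U₁ U₂) with divide (split⇒cut p) T
  ... | T₁ , T₂ , T≐ =
    refine-swap (refine-node p p T T≐
      (refine-swap (refine T₁ U₁)) (refine-swap (refine T₂ U₂)))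

  -- Carving an element out of selected leaves.

  record Carving (T : Tree K l e) (S : K → Bool) (u : Carrier) : Set (c ⊔ ℓ) where
    field
      tree     : Tree (K × Bool) l e
      μ-fst    : ∀ S₁ → μ tree (S₁ ∘ proj₁) ≈ μ T S₁
      μ-carved : μ tree (λ (k , b) → S k ∧ b) ≈ u

  -- Homogeneity distributes `u` over the two subtrees. At a selected leaf the hypotheses are those
  -- of a fine split; at an unselected one `u` is zero.
  carve : (T : Tree K l e) (S : K → Bool) →
          u ≤ μ T S → u ⊥ μ T S → Carving T S u
  carve {u = u} (leaf k) S (r , u⊕r) u⊥ with S k in eq
  ... | true = record
    { tree     = node p (leaf (k , true)) (leaf (k , false))
    ; μ-fst    = λ S₁ → ⊕-functional
        (μ-node p (leaf (k , true)) (leaf (k , false)) (S₁ ∘ proj₁))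
        (share-⊕ u⊕r (S₁ k))
    ; μ-carved = carved eq
        (μ-node p (leaf (k , true)) (leaf (k , false)) λ (k , b) → S k ∧ b)
    }
    where
    p = fine u⊥ u⊕r
    carved : ∀ {b} → b ≡ true →
             proj₁ (share (b ∧ true) u) ⊕ proj₁ (share (b ∧ false) r) ≐ w → w ≈ u
    carved ≡.refl q = ⊕-functional q (⊕-identityʳ u)
  ... | false = record
    { tree     = leaf (k , false)
    ; μ-fst    = λ S₁ → refl
    ; μ-carved = carved eq
    }
    where
    carved : ∀ {b} → b ≡ false → proj₁ (share (b ∧ false) e) ≈ u
    carved ≡.refl = sym (x⊕y≐0⇒x≈0 u⊕r)
  carve {u = u} (node p T₁ T₂) S (r , u⊕r) u⊥
    with homogeneous u _ _ _ (μ-node p T₁ T₂ S) (r , u⊕r) (⊥⇒≤′ u⊥)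
  ... | u₁ , u₂ , u₁≤ , u₂≤ , u₁⊕u₂ = record
    { tree     = node p C₁.tree C₂.tree
    ; μ-fst    = λ S₁ → ≐-cong (C₁.μ-fst S₁) (C₂.μ-fst S₁)
                   (μ-node p C₁.tree C₂.tree _) (μ-node p T₁ T₂ S₁)
    ; μ-carved = ≐-cong C₁.μ-carved C₂.μ-carved (μ-node p C₁.tree C₂.tree _) u₁⊕u₂
    }
    where
    module C₁ = Carving (carve T₁ S u₁≤
      (⊥-mono (_ , u₁⊕u₂) (_ , μ-node p T₁ T₂ S) u⊥))
    module C₂ = Carving (carve T₂ S u₂≤
      (⊥-mono (_ , ⊕-comm u₁⊕u₂) (_ , ⊕-comm (μ-node p T₁ T₂ S)) u⊥))
  carve (base T) S u≤ u⊥ = record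
    { tree = base C.tree ; μ-fst = C.μ-fst ; μ-carved = C.μ-carved }
    where module C = Carving (carve T S u≤ u⊥)

  -- The sub-effect algebra of subsums.

  Hull : Pred Carrier (c ⊔ ℓ)
  Hull x = Σ (Tree Bool coarse 1#) λ T → μ T id ≈ x

  μ∈Hull : (T : Tree K coarse 1#) (S : K → Bool) → μ T S ∈ Hull
  μ∈Hull T S = map S T , μ-map S T id

  Hull-resp : x ≈ y → x ∈ Hull → y ∈ Hull
  Hull-resp p (T , q) = T , trans q p

  B⊆Hull : B ⊆ Hull
  B⊆Hull {x} x∈ = node p (base (leaf true)) (base (leaf false)) ,
    ⊕-functional (μ-node p (base (leaf true)) (base (leaf false)) id) (⊕-identityʳ x)
    where p = coarse x∈ (B.summandʳ (⊕-complement x) x∈ B.1∈) (⊕-complement x)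

  1∈Hull : 1# ∈ Hull
  1∈Hull = B⊆Hull B.1∈

  Hull-complement : x ∈ Hull → x ⊕ y ≐ 1# → y ∈ Hull
  Hull-complement (T , T≈x) x⊕y = Hull-resp
    (complement-unique
      (⊕-resp T≈x refl (μ-const T true) (μ-additive T λ { true → left ; false → right }))
      x⊕y)
    (μ∈Hull T not)

  -- Orthogonal elements are realized by disjoint selections in one tree, so that their sum is again
  -- a subsum.
  record Summands (x y : Carrier) : Set (c ⊔ ℓ) where
    field
      tree       : Tree ((Bool × Bool) × Bool) coarse 1#
      {S₁ S₂ S₃} : (Bool × Bool) × Bool → Bool
      disjoint   : ∀ k → S₁ k ⊎ S₂ k ≐ S₃ k
      μ₁         : μ tree S₁ ≈ x
      μ₂         : μ tree S₂ ≈ y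

  -- Refine the trees of x and y into one, with parts p = x ∩ y, q = x ∖ y,
  -- s = y ∖ x and t.  As x ⊕ y = (p ⊕ q) ⊕ (p ⊕ s) is defined, p ≤ t and p ⊥ t,
  -- so a second copy of p can be carved out of t to make y disjoint from x.
  summands : x ∈ Hull → y ∈ Hull → x ⊥ y → Summands x y
  summands {x} {y} (T , T≈x) (U , U≈y) (z , x⊕y) = record
    { tree     = C.tree
    ; S₁       = λ ((i , j) , k) → i
    ; S₂       = λ ((i , j) , k) → (not i ∧ j) ∨ ((not i ∧ not j) ∧ k)
    ; S₃       = λ ((i , j) , k) → i ∨ (j ∨ k)
    ; μ₁       = trans (C.μ-fst proj₁) W-x
    ; μ₂       = sym (⊕-functional p⊕s y-carved)
    ; disjoint = λ
        { ((true  , true)  , true)  → left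
        ; ((true  , true)  , false) → left
        ; ((true  , false) , true)  → left
        ; ((true  , false) , false) → left
        ; ((false , true)  , true)  → right
        ; ((false , true)  , false) → right
        ; ((false , false) , true)  → right
        ; ((false , false) , false) → neither
        }
    }
    where
    module W = Refinement (refine T U)
    both onlyʳ none : Bool × Bool → Bool
    both  (i , j) = i ∧ j
    onlyʳ (i , j) = not i ∧ j
    none  (i , j) = not i ∧ not j
    W-x : μ W.tree proj₁ ≈ x
    W-x = trans (W.μ-fst id) T≈x
    W-y : μ W.tree proj₂ ≈ y
    W-y = trans (W.μ-snd id) U≈y
    p⊕s : μ W.tree both ⊕ μ W.tree onlyʳ ≐ y
    p⊕s = ⊕-resp-sum W-y (μ-additive W.tree λ
      { (true , true) → left ; (true , false) → neither
      ; (false , true) → right ; (false , false) → neither })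
    x⊕x̄ : x ⊕ μ W.tree (not ∘ proj₁) ≐ 1#
    x⊕x̄ = ⊕-resp W-x refl (μ-const W.tree true) (μ-additive W.tree λ
      { (true , _) → left ; (false , _) → right })
    s⊕t : μ W.tree onlyʳ ⊕ μ W.tree none ≐ μ W.tree (not ∘ proj₁)
    s⊕t = μ-additive W.tree λ
      { (true , _) → neither
      ; (false , true) → left ; (false , false) → right }
    -- Both `y ⊕ z ′` and `s ⊕ t` are the complement of `x`; cancelling `s` shows that `t` is
    -- `p ⊕ z ′`.
    p≤t : μ W.tree both ≤ μ W.tree none
    p≤t with ⊕-assocʳ x⊕y (⊕-complement z)
    ... | _ , y⊕z′ , x⊕yz′ with ⊕-assocʳ (⊕-comm p⊕s) y⊕z′
    ... | _ , p⊕z′ , s⊕pz′ = z ′ , ⊕-resp-sum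
      (⊕-cancelˡ (⊕-resp-sum (⊕-cancelˡ x⊕yz′ x⊕x̄) s⊕pz′) s⊕t) p⊕z′
    p⊥t : μ W.tree both ⊥ μ W.tree none
    p⊥t = _ , μ-additive W.tree {S = λ (i , j) → (i ∧ j) ∨ (not i ∧ not j)} λ
      { (true , true) → left ; (true , false) → neither
      ; (false , true) → neither ; (false , false) → right }
    module C = Carving (carve W.tree none p≤t p⊥t)
    y-carved : μ W.tree both ⊕ μ W.tree onlyʳ ≐
               μ C.tree (λ ((i , j) , k) → (not i ∧ j) ∨ ((not i ∧ not j) ∧ k))
    y-carved = ⊕-comm (⊕-resp (C.μ-fst onlyʳ) C.μ-carved refl (μ-additive C.tree λ
        { ((true  , _) , _)  → neither
        ; ((false , true)  , _) → left
        ; ((false , false) , true)  → right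
        ; ((false , false) , false) → neither
        }))

  Hull-sum : x ⊕ y ≐ z → x ∈ Hull → y ∈ Hull → z ∈ Hull
  Hull-sum x⊕y x∈ y∈ = Hull-resp
    (≐-cong S.μ₁ S.μ₂ (μ-additive S.tree S.disjoint) x⊕y) (μ∈Hull S.tree S.S₃)
    where module S = Summands (summands x∈ y∈ (_ , x⊕y))

  -- `y` is the complement of `x ⊕ z ′`.
  Hull-summandʳ : x ⊕ y ≐ z → x ∈ Hull → z ∈ Hull → y ∈ Hull
  Hull-summandʳ {z = z} x⊕y x∈ z∈ with ⊕-assocʳ (⊕-comm x⊕y) (⊕-complement z)
  ... | _ , x⊕z′ , y⊕xz′ = Hull-complement
    (Hull-sum x⊕z′ x∈ (Hull-complement z∈ (⊕-complement z))) (⊕-comm y⊕xz′)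

  Hull-isSubEffectAlgebra : IsSubEffectAlgebra E Hull
  Hull-isSubEffectAlgebra = record
    { resp     = Hull-resp
    ; 1∈       = 1∈Hull
    ; sum∈     = Hull-sum
    ; summandʳ = Hull-summandʳ
    ; summandˡ = λ p → Hull-summandʳ (⊕-comm p)
    }

  Hull-downward : x ∈ Hull → u ≤ x → u ⊥ x → u ∈ Hull
  Hull-downward {x} {u} (T , T≈x) (r , u⊕r) (s , u⊕x) =
    Hull-resp C.μ-carved (μ∈Hull C.tree _)
    where
    module C = Carving (carve T id (r , ⊕-resp-sum (sym T≈x) u⊕r)
                                   (s , ⊕-respʳ (sym T≈x) u⊕x))

  -- Riesz decomposition for subsums.

  ∧-⊎ : ∀ i {b₁ b₂ b₃} → b₁ ⊎ b₂ ≐ b₃ → (i ∧ b₁) ⊎ (i ∧ b₂) ≐ (i ∧ b₃)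
  ∧-⊎ true  p = p
  ∧-⊎ false p = neither

  ∧-⊎-not∧ : ∀ i j → (i ∧ j) ⊎ (not i ∧ j) ≐ j
  ∧-⊎-not∧ true  true  = left
  ∧-⊎-not∧ true  false = neither
  ∧-⊎-not∧ false true  = right
  ∧-⊎-not∧ false false = neither

  ∧-⊎-∧not : ∀ i j → (i ∧ j) ⊎ (i ∧ not j) ≐ i
  ∧-⊎-∧not true  true  = left
  ∧-⊎-∧not true  false = right
  ∧-⊎-∧not false _     = neither

  ⊎-∨ : ∀ i j → j ⊎ (i ∧ not j) ≐ (i ∨ j)
  ⊎-∨ true  true  = left
  ⊎-∨ true  false = right
  ⊎-∨ false true  = left
  ⊎-∨ false false = neither

  -- Here m = u ∩ v ′ lies below both v and v ′, hence homogeneity distributes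
  -- it over s₁ = v₁ ∖ u and s₂ = v₂ ∖ u.
  riesz-from-refinement : ∀ {u₁ u₂ m s₁ s₂ v₁ v₂} →
    u₁ ⊕ u₂ ≐ w → w ⊕ m ≐ u → s₁ ⊕ s₂ ≐ s → w ⊕ s ≐ v →
    u₁ ⊕ s₁ ≐ v₁ → u₂ ⊕ s₂ ≐ v₂ → u ≤ v → m ⊥ v →
    u₁ ∈ Hull → u₂ ∈ Hull → v ∈ Hull →
    ∃₂ λ a₁ a₂ → a₁ ∈ Hull × a₂ ∈ Hull × a₁ ≤ v₁ × a₂ ≤ v₂ × a₁ ⊕ a₂ ≐ u
  riesz-from-refinement {s = s} {v = v} {m = m} u₁⊕u₂ w⊕m s₁⊕s₂ w⊕s u₁⊕s₁ u₂⊕s₂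
    (r , u⊕r) m⊥v u₁∈ u₂∈ v∈ =
    let _ , m⊕r , w⊕mr = ⊕-assocʳ w⊕m u⊕r
        s≤v = _ , ⊕-comm w⊕s
        m≤s = r , ⊕-resp-sum (⊕-cancelˡ w⊕mr w⊕s) m⊕r
        -- Homogeneity yields pieces of `m` in `E` only; being below `v` and orthogonal to it puts
        -- them into `Hull`.
        part∈ : ∀ {n} → n ≤ m → n ∈ Hull
        part∈ n≤m = Hull-downward v∈ (≤-trans n≤m (≤-trans m≤s s≤v))
                                     (⊥-mono n≤m ≤-refl m⊥v)
        m₁ , m₂ , (n₁ , m₁⊕n₁) , (n₂ , m₂⊕n₂) , m₁⊕m₂ =
          homogeneous m _ _ s s₁⊕s₂ m≤s (⊥⇒≤′ (⊥-mono ≤-refl s≤v m⊥v))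
        a₁ , a₂ , u₁⊕m₁ , u₂⊕m₂ , a₁⊕a₂ = ⊕-medial u₁⊕u₂ m₁⊕m₂ w⊕m
    in a₁ , a₂
       , Hull-sum u₁⊕m₁ u₁∈ (part∈ (m₂ , m₁⊕m₂))
       , Hull-sum u₂⊕m₂ u₂∈ (part∈ (m₁ , ⊕-comm m₁⊕m₂))
       , (n₁ , ⊕-assocˡ-≐ m₁⊕n₁ u₁⊕s₁ u₁⊕m₁)
       , (n₂ , ⊕-assocˡ-≐ m₂⊕n₂ u₂⊕s₂ u₂⊕m₂)
       , a₁⊕a₂

  -- In one common tree `v₁` and `v₂` are disjoint selections, so intersecting them with the
  -- selection of `u` and with its complement supplies all the pieces.
  Hull-riesz : RieszDecomposition (subEffectAlgebra E Hull-isSubEffectAlgebra)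
  Hull-riesz (u , T , T≈u) (v₁ , v₁∈) (v₂ , v₂∈) (v , v∈) v₁⊕v₂ ((r , _) , u⊕r) =
    let a₁ , a₂ , a₁∈ , a₂∈ , (n₁ , a₁⊕n₁) , (n₂ , a₂⊕n₂) , a₁⊕a₂ = refined
    in (a₁ , a₁∈) , (a₂ , a₂∈)
       , ((n₁ , Hull-summandʳ a₁⊕n₁ a₁∈ v₁∈) , a₁⊕n₁)
       , ((n₂ , Hull-summandʳ a₂⊕n₂ a₂∈ v₂∈) , a₂⊕n₂)
       , a₁⊕a₂
    where
    module V = Summands (summands v₁∈ v₂∈ (v , v₁⊕v₂))
    module W = Refinement (refine T V.tree)
    W-u : μ W.tree proj₁ ≈ u
    W-u = trans (W.μ-fst id) T≈u
    W-v₁ : μ W.tree (V.S₁ ∘ proj₂) ≈ v₁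
    W-v₁ = trans (W.μ-snd V.S₁) V.μ₁
    W-v₂ : μ W.tree (V.S₂ ∘ proj₂) ≈ v₂
    W-v₂ = trans (W.μ-snd V.S₂) V.μ₂
    W-v : μ W.tree (V.S₃ ∘ proj₂) ≈ v
    W-v = ≐-cong W-v₁ W-v₂ (μ-additive W.tree λ (i , k) → V.disjoint k) v₁⊕v₂
    refined : ∃₂ λ a₁ a₂ → a₁ ∈ Hull × a₂ ∈ Hull × a₁ ≤ v₁ × a₂ ≤ v₂ × a₁ ⊕ a₂ ≐ u
    refined = riesz-from-refinement
      (μ-additive W.tree {S = λ (i , k) → i ∧ V.S₃ k} λ (i , k) → ∧-⊎ i (V.disjoint k))
      (⊕-resp-sum W-u (μ-additive W.tree λ (i , k) → ∧-⊎-∧not i (V.S₃ k)))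
      (μ-additive W.tree {S = λ (i , k) → not i ∧ V.S₃ k}
        λ (i , k) → ∧-⊎ (not i) (V.disjoint k))
      (⊕-resp-sum W-v (μ-additive W.tree λ (i , k) → ∧-⊎-not∧ i (V.S₃ k)))
      (⊕-resp-sum W-v₁ (μ-additive W.tree λ (i , k) → ∧-⊎-not∧ i (V.S₁ k)))
      (⊕-resp-sum W-v₂ (μ-additive W.tree λ (i , k) → ∧-⊎-not∧ i (V.S₂ k)))
      (r , u⊕r)
      -- The part of `u` outside `v` is selected disjointly from `v`.
      (⊥-comm (_ , ⊕-respˡ W-v
        (μ-additive W.tree {S = λ (i , k) → i ∨ V.S₃ k} λ (i , k) → ⊎-∨ i (V.S₃ k))))
      (μ∈Hull W.tree _) (μ∈Hull W.tree _) v∈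

-- Meets in blocks.

module _ (E : EffectAlgebra c ℓ) (homogeneous : Homogeneous E)
  (B : Pred (EffectAlgebra.Carrier E) (c ⊔ ℓ)) (block : IsBlock E B) where

  open EffectAlgebra E
  open EffectAlgebraProperties E
  open IsBlock block
  open IsSubEffectAlgebra isSubEffectAlgebra
  private
    module F = EffectAlgebra algebra
    module FP = EffectAlgebraProperties algebra

  block-downward : ∀ {x u} → x ∈ B → u ≤ x → u ⊥ x → u ∈ B
  block-downward x∈ u≤x u⊥x =
    maximal Hull Hull-isSubEffectAlgebra Hull-riesz B⊆Hull
      (Hull-downward (B⊆Hull x∈) u≤x u⊥x)
    where open Trees E homogeneous B isSubEffectAlgebra riesz

  block-hasMeet : MaximalityProperty E → ∀ x y → F.HasMeet x y
  block-hasMeet maximality = FP.hasMeet riesz disjointify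
    where
    disjointify : ∀ x y → x FP.⊥ y → ∃ λ u → ∃₂ λ a b → u F.⊕ a ≐ x × u F.⊕ b ≐ y ×
                  (∀ t → t F.≤ a → t F.≤ b → t F.≈ F.0#)
    disjointify (x , x∈) (y , y∈) (_ , x⊕y) with maximality x y
    ... | u , ((a , u⊕a) , (b , u⊕b)) , u-maximal =
      (u , u∈) , (a , summandʳ u⊕a u∈ x∈) , (b , summandʳ u⊕b u∈ y∈) , u⊕a , u⊕b ,
      λ { _ (_ , t⊕i) (_ , t⊕j) →
        -- For `t` below both remainders, `u ⊕ t` is a lower bound of `x` and `y` above `u`, hence
        -- equal to `u`.
        let ut , u⊕t , ut⊕i = ⊕-assocˡ t⊕i u⊕a
            ut≤y = _ , ⊕-assocˡ-≐ t⊕j u⊕b u⊕t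
            ut≈u = u-maximal ut ((_ , ut⊕i) , ut≤y) (_ , u⊕t)
        in x⊕y≐x⇒y≈0 (⊕-resp-sum ut≈u u⊕t) }
      where
      u∈ : u ∈ B
      -- `u ⊥ x` because `u ≤ y` and `y ⊥ x`.
      u∈ = block-downward x∈ (a , u⊕a) (⊥-mono (b , u⊕b) ≤-refl (_ , ⊕-comm x⊕y))

theorem3p12 : ∀ {c ℓ} (E : EffectAlgebra c ℓ) →
    Homogeneous E → MaximalityProperty E →
    (B : Pred (EffectAlgebra.Carrier E) (c ⊔ ℓ)) (block : IsBlock E B) →
    LatticeOrdered (IsBlock.algebra block) ×
    DifferenceMeet (IsBlock.algebra block)
theorem3p12 E homogeneous maximality B block =
  EffectAlgebraProperties.lattice (IsBlock.algebra block)
    (λ x y → proj₁ (meet x y)) (λ x y → proj₂ (meet x y)) ,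
  λ _ _ z d _ _ _ _ → meet d z
  where meet = block-hasMeet E homogeneous B block maximality
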